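{- Let $k\geq 2$ be an integer and let $r$ be a rational number with $0\leq r<k-1$. There exists some collection $\mathcal{F}$ of $k$-hypergraphs such that $ex(n,\mathcal{F})=\Theta(n^{k-r})$.
   Context: A $k$-hypergraph is a set of vertices together with a collection of $k$-element subsets of the vertices (edges). A $k$-hypergraph $X$ contains $G$ as a subgraph if there is an injective map $f$ from the vertices of $G$ to the vertices of $X$ such that for every edge $\{x_1,\dots,x_k\}$ of $G$, $\{f(x_1),\dots,f(x_k)\}$ is an edge of $X$. For a family $\mathcal{F}$ of $k$-hypergraphs, $ex(n,\mathcal{F})$ is the maximum number of edges of a $k$-hypergraph on $n$ vertices containing no member of $\mathcal{F}$ as a subgraph. $\Theta$ refers to $n\to\infty$. -}

module Defs where

open import Level using (0ℓ)
open import Data.Fin.Base using (Fin)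
open import Data.Fin.Properties using (any?) renaming (_≟_ to _≟ᶠ_)
open import Data.Fin.Subset using (Subset; _∈_; ∣_∣)
open import Data.Fin.Subset.Properties using (_∈?_)
open import Data.Integer.Base as ℤ using (ℤ; +_; -[1+_])
open import Data.List.Base using (List; length)
import Data.List.Membership.Propositional as List
open import Data.List.Relation.Unary.All using (All)
open import Data.List.Relation.Unary.Unique.Propositional using (Unique)
open import Data.Nat.Base using (ℕ; suc; _*_; _^_; _≤_)
open import Data.Product.Base using (Σ-syntax; ∃-syntax; _×_)
open import Data.Rational.Base as ℚ using (ℚ; ↥_; ↧ₙ_)
open import Data.Vec.Base using (tabulate)
open import Function.Definitions using (Injective)
open import Relation.Binary.PropositionalEquality using (_≡_)
open import Relation.Nullary.Decidable using (does; _×-dec_)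
open import Relation.Nullary.Negation using (¬_)
open import Relation.Unary using (Pred)

-- The edge set is a duplicate-free list; its order plays no role below.
record Hypergraph (k n : ℕ) : Set where
  field
    edges   : List (Subset n)
    unique  : Unique edges
    uniform : All (λ e → ∣ e ∣ ≡ k) edges

open Hypergraph public

∣E_∣ : ∀ {k n} → Hypergraph k n → ℕ
∣E X ∣ = length (edges X)

image : ∀ {m n} → (Fin m → Fin n) → Subset m → Subset n
image f s = tabulate λ y → does (any? λ x → (x ∈? s) ×-dec (f x ≟ᶠ y))

_Contains_ : ∀ {k n m} → Hypergraph k n → Hypergraph k m → Set
_Contains_ {n = n} {m} X G =
  Σ[ f ∈ (Fin m → Fin n) ] Injective _≡_ _≡_ f ×
    (∀ e → e List.∈ edges G → image f e List.∈ edges X)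

-- A possibly infinite collection, given by its members on each vertex set Fin m.
Family : ℕ → Set₁
Family k = (m : ℕ) → Pred (Hypergraph k m) 0ℓ

_Free : ∀ {k n} → Family k → Pred (Hypergraph k n) 0ℓ
(F Free) X = ∀ m (G : Hypergraph _ m) → F m G → ¬ (X Contains G)

-- The relation "ex(n, F) = e".
record IsEx {k} (F : Family k) (n e : ℕ) : Set where
  field
    attained : Σ[ X ∈ Hypergraph k n ] (F Free) X × ∣E X ∣ ≡ e
    maximal  : ∀ (X : Hypergraph k n) → (F Free) X → ∣E X ∣ ≤ e

-- Comparisons with the real number n^(p/q), for n, q ≥ 1, are expressed by
-- taking q-th powers (and clearing the denominator if p < 0).

-- x ≤ n^(p/q)·c
_≤[_^_/_]·_ : ℕ → ℕ → ℤ → ℕ → ℕ → Set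
x ≤[ n ^ + a      / q ]· c = x ^ q ≤ n ^ a * c ^ q
x ≤[ n ^ -[1+ a ] / q ]· c = n ^ suc a * x ^ q ≤ c ^ q

-- n^(p/q) ≤ c·x
[_^_/_]≤_·_ : ℕ → ℤ → ℕ → ℕ → ℕ → Set
[ n ^ + a      / q ]≤ c · x = n ^ a ≤ (c * x) ^ q
[ n ^ -[1+ a ] / q ]≤ c · x = 1 ≤ n ^ suc a * (c * x) ^ q

-- f(n) = Θ(n^α) as n → ∞.  Natural constants lose nothing: any positive real
-- constants C₁, C₂ with n^α ≤ C₁ f(n) and f(n) ≤ C₂ n^α may be rounded up.
_=Θ[n^_] : (ℕ → ℕ) → ℚ → Set
f =Θ[n^ α ] = ∃[ c ] ∃[ C ] ∃[ N ] ∀ n → N ≤ n →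
  ([ n ^ ↥ α / ↧ₙ α ]≤ c · f n) × (f n ≤[ n ^ ↥ α / ↧ₙ α ]· C)

fromℕ : ℕ → ℚ
fromℕ k = + k ℚ./ 1

{-# OPTIONS --safe #-}

-- Put α = k - r = a / q and let F consist of the hypergraphs having some set of m
-- vertices that spans more than C (1 + m) ^ α edges.  Sparsity is inherited by
-- subgraphs, so the F-free hypergraphs are exactly the sparse ones, and the upper
-- bound is immediate.  For the lower bound take k parts of size N = 2 ^ (q L), split
-- the N ^ k transversals into N ^ α blocks of size N ^ r, and keep one edge from each
-- block.  If the edges are picked at random, the number X of edges inside a set of m
-- vertices satisfies E z ^ X ≤ exp (m ^ α) for z = (N / m) ^ r, which beats the union
-- bound over all sets because α > 1.  The choice is made by conditional expectations,
-- and only dyadic sizes m = 2 ^ (q j) with j < L are tested, so that every quantity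
-- is a natural number.
module Submission where

open import Data.Bool.Base using (true)
open import Data.Bool.Properties using () renaming (_≟_ to _≟ᵇ_)
open import Data.Fin.Base as Fin using (Fin; zero; suc)
open import Data.Fin.Properties using (any?) renaming (_≟_ to _≟ᶠ_)
open import Data.Fin.Subset
  using (Subset; _∈_; _⊆_; ∣_∣; ⊥; ⊤; ⁅_⁆; _∪_; _-_; inside; outside)
open import Data.Fin.Subset.Properties
import Data.Integer.Base as ℤ
import Data.Integer.Properties as ℤ
open import Data.List.Base as List
  using (List; []; _∷_; [_]; _++_; length; filter; map; take; drop; allFin; cartesianProductWith)
import Data.List.Membership.Propositional as List
open import Data.List.Membership.Propositional.Properties
  using (∈-∃++; ∈-filter⁺; ∈-filter⁻; ∈-++⁺ˡ; ∈-++⁺ʳ; ∈-++⁻; ∈-map⁺; ∈-map⁻; ∈-allFin;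
         ∈-cartesianProductWith⁺)
open import Data.List.Properties
  using (length-++; length-map; length-take; length-drop; length-tabulate; length-filter;
         filter-all; filter-none; filter-++; map-++; map-∘; map-id; take++drop≡id)
open import Data.List.Relation.Binary.Sublist.Propositional
  using ([]; _∷_; _∷ʳ_; from∈) renaming (_⊆_ to _⊑_; ⊆-refl to ⊑-refl)
import Data.List.Relation.Binary.Sublist.Propositional.Properties as Sublist
open import Data.List.Relation.Unary.All as All using (All; []; _∷_)
import Data.List.Relation.Unary.All.Properties as All
open import Data.List.Relation.Unary.AllPairs using ([]; _∷_)
open import Data.List.Relation.Unary.Any using (here; there)
open import Data.List.Relation.Unary.Unique.DecPropositional using (unique?)
open import Data.List.Relation.Unary.Unique.Propositional using (Unique)
import Data.List.Relation.Unary.Unique.Propositional.Properties as Unique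
open import Data.Nat.Base
open import Data.Nat.Coprimality using (1-coprimeTo) renaming (sym to coprime-sym)
open import Data.Nat.ListAction using (sum)
open import Data.Nat.ListAction.Properties using (sum-++)
open import Data.Nat.Properties
open import Data.Nat.Tactic.RingSolver using (solve-∀)
open import Data.Product.Base using (Σ-syntax; ∃-syntax; _×_; _,_; proj₁; proj₂)
open import Data.Rational.Base as ℚ using (ℚ; 0ℚ; 1ℚ; mkℚ)
import Data.Rational.Properties as ℚ
open import Data.Sum.Base using (inj₁; inj₂; [_,_]′)
open import Data.Vec.Base as Vec using ([]; _∷_)
import Data.Vec.Properties as Vec
open import Function.Base using (id; _∘_)
open import Function.Definitions using (Injective)
open import Level using (0ℓ)
open import Relation.Binary.Definitions using (DecidableEquality)
open import Relation.Binary.PropositionalEquality hiding ([_])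
open import Relation.Nullary.Decidable
  using (Dec; yes; no; does; _×-dec_; ¬?; decidable-stable; dec-true; map′)
open import Relation.Nullary.Negation using (¬_; contradiction)
open import Relation.Unary using (Pred; Decidable)
open import Defs

private
  variable
    X Y Z : Set
    k m n : ℕ

-- Finite subsets and their images under maps.

Unique-⊆⇒length≤ : {xs ys : List X} → Unique xs → (∀ {x} → x List.∈ xs → x List.∈ ys) →
  length xs ≤ length ys
Unique-⊆⇒length≤ [] _ = z≤n
Unique-⊆⇒length≤ {xs = x ∷ xs} (x∉xs ∷ xs!) xs⊆ys with ∈-∃++ (xs⊆ys (here refl))
... | as , bs , refl = begin
  suc (length xs)         ≤⟨ s≤s (Unique-⊆⇒length≤ xs! rest) ⟩
  suc (length (as ++ bs)) ≡⟨ cong suc (length-++ as) ⟩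
  suc (length as + length bs) ≡⟨ +-suc (length as) _ ⟨
  length as + length (x ∷ bs) ≡⟨ length-++ as ⟨
  length (as ++ x ∷ bs)   ∎
  where
  open ≤-Reasoning
  rest : ∀ {y} → y List.∈ xs → y List.∈ as ++ bs
  rest y∈xs with ∈-++⁻ as (xs⊆ys (there y∈xs))
  ... | inj₁ y∈as = ∈-++⁺ˡ y∈as
  ... | inj₂ (here refl) = contradiction refl (All.lookup x∉xs y∈xs)
  ... | inj₂ (there y∈bs) = ∈-++⁺ʳ as y∈bs

∣p∪q∣≤∣p∣+∣q∣ : (p q : Subset n) → ∣ p ∪ q ∣ ≤ ∣ p ∣ + ∣ q ∣
∣p∪q∣≤∣p∣+∣q∣ [] [] = z≤n
∣p∪q∣≤∣p∣+∣q∣ (outside ∷ p) (outside ∷ q) = ∣p∪q∣≤∣p∣+∣q∣ p q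
∣p∪q∣≤∣p∣+∣q∣ (outside ∷ p) (inside ∷ q) =
  ≤-trans (s≤s (∣p∪q∣≤∣p∣+∣q∣ p q)) (≤-reflexive (sym (+-suc ∣ p ∣ ∣ q ∣)))
∣p∪q∣≤∣p∣+∣q∣ (inside ∷ p) (outside ∷ q) = s≤s (∣p∪q∣≤∣p∣+∣q∣ p q)
∣p∪q∣≤∣p∣+∣q∣ (inside ∷ p) (inside ∷ q) =
  s≤s (≤-trans (∣p∪q∣≤∣p∣+∣q∣ p q) (+-monoʳ-≤ ∣ p ∣ (n≤1+n ∣ q ∣)))

∣p∪⁅x⁆∣≤1+∣p∣ : (p : Subset n) (x : Fin n) → ∣ p ∪ ⁅ x ⁆ ∣ ≤ suc ∣ p ∣
∣p∪⁅x⁆∣≤1+∣p∣ p x = begin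
  ∣ p ∪ ⁅ x ⁆ ∣     ≤⟨ ∣p∪q∣≤∣p∣+∣q∣ p ⁅ x ⁆ ⟩
  ∣ p ∣ + ∣ ⁅ x ⁆ ∣ ≡⟨ cong (∣ p ∣ +_) (∣⁅x⁆∣≡1 x) ⟩
  ∣ p ∣ + 1         ≡⟨ +-comm ∣ p ∣ 1 ⟩
  suc ∣ p ∣         ∎
  where open ≤-Reasoning

p⊆p-x∪⁅x⁆ : (p : Subset n) (x : Fin n) → p ⊆ (p - x) ∪ ⁅ x ⁆
p⊆p-x∪⁅x⁆ p x {y} y∈p with y ≟ᶠ x
... | yes refl = x∈p∪q⁺ (inj₂ (x∈⁅x⁆ x))
... | no y≢x = x∈p∪q⁺ (inj₁ (x∈p∧x≢y⇒x∈p-y y∈p y≢x))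

∈-image⁺ : (f : Fin m → Fin n) (s : Subset m) {x : Fin m} → x ∈ s → f x ∈ image f s
∈-image⁺ f s {x} x∈s = Vec.lookup⇒[]= (f x) (image f s) (trans (Vec.lookup∘tabulate _ (f x)) hit)
  where
  hit : does (any? λ x′ → (x′ ∈? s) ×-dec (f x′ ≟ᶠ f x)) ≡ true
  hit = dec-true (any? _) (x , x∈s , refl)

∈-image⁻ : (f : Fin m → Fin n) (s : Subset m) {y : Fin n} →
  y ∈ image f s → ∃[ x ] x ∈ s × f x ≡ y
∈-image⁻ f s {y} y∈ with any? (λ x → (x ∈? s) ×-dec (f x ≟ᶠ y))
                       | trans (sym (Vec.lookup∘tabulate (λ y → does (any? λ x → (x ∈? s) ×-dec (f x ≟ᶠ y))) y))
                               (Vec.[]=⇒lookup y∈)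
... | yes p | _ = p
... | no _ | ()

image-mono : (f : Fin m → Fin n) {s t : Subset m} → s ⊆ t → image f s ⊆ image f t
image-mono f {s} {t} s⊆t y∈ with ∈-image⁻ f s y∈
... | x , x∈s , refl = ∈-image⁺ f t (s⊆t x∈s)

image-injective : {f : Fin m → Fin n} → Injective _≡_ _≡_ f → Injective _≡_ _≡_ (image f)
image-injective {f = f} inj {s} {t} eq = ⊆-antisym (half s t eq) (half t s (sym eq))
  where
  half : ∀ s t → image f s ≡ image f t → s ⊆ t
  half s t eq {x} x∈s with ∈-image⁻ f t (subst (f x ∈_) eq (∈-image⁺ f s x∈s))
  ... | x′ , x′∈t , fx′≡fx = subst (_∈ t) (inj fx′≡fx) x′∈t

image-id : (s : Subset n) → image id s ≡ s
image-id s = ⊆-antisym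
  (λ y∈ → let _ , x∈s , eq = ∈-image⁻ id s y∈ in subst (_∈ s) eq x∈s)
  (∈-image⁺ id s)

∣image∣≤ : (f : Fin m → Fin n) (b : ℕ) (s : Subset m) → ∣ s ∣ ≤ b → ∣ image f s ∣ ≤ b
∣image∣≤ {n = n} f b s ∣s∣≤b with nonempty? s
... | no s-empty = ≤-trans (p⊆q⇒∣p∣≤∣q∣ {q = ⊥} λ y∈ →
        contradiction (let x , x∈s , _ = ∈-image⁻ f s y∈ in x , x∈s) s-empty)
        (≤-trans (≤-reflexive (∣⊥∣≡0 n)) z≤n)
∣image∣≤ f zero s ∣s∣≤0 | yes (x , x∈s) = contradiction (<-≤-trans (x∈p⇒∣p-x∣<∣p∣ x∈s) ∣s∣≤0) (λ ())
∣image∣≤ f (suc b) s ∣s∣≤1+b | yes (x , x∈s) = begin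
  ∣ image f s ∣                 ≤⟨ p⊆q⇒∣p∣≤∣q∣ cover ⟩
  ∣ image f (s - x) ∪ ⁅ f x ⁆ ∣ ≤⟨ ∣p∪⁅x⁆∣≤1+∣p∣ (image f (s - x)) (f x) ⟩
  suc ∣ image f (s - x) ∣       ≤⟨ s≤s (∣image∣≤ f b (s - x) (≤-pred (≤-trans (x∈p⇒∣p-x∣<∣p∣ x∈s) ∣s∣≤1+b))) ⟩
  suc b                         ∎
  where
  open ≤-Reasoning
  cover : image f s ⊆ image f (s - x) ∪ ⁅ f x ⁆
  cover y∈ with ∈-image⁻ f s y∈
  ... | z , z∈s , refl with x∈p∪q⁻ (s - x) ⁅ x ⁆ (p⊆p-x∪⁅x⁆ s x z∈s)
  ...   | inj₁ z∈s-x = x∈p∪q⁺ (inj₁ (∈-image⁺ f (s - x) z∈s-x))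
  ...   | inj₂ z∈⁅x⁆ = x∈p∪q⁺ (inj₂ (subst (λ w → f w ∈ ⁅ f x ⁆) (sym (x∈⁅y⁆⇒x≡y x z∈⁅x⁆)) (x∈⁅x⁆ (f x))))

-- Edges spanned by a vertex set.

count : {P : Pred X 0ℓ} → Decidable P → List X → ℕ
count P? xs = length (filter P? xs)

count-++ : {P : Pred X 0ℓ} (P? : Decidable P) (xs ys : List X) →
  count P? (xs ++ ys) ≡ count P? xs + count P? ys
count-++ P? xs ys = trans (cong length (filter-++ P? xs ys)) (length-++ (filter P? xs))

spanned : List (Subset n) → Subset n → ℕ
spanned es s = count (_⊆? s) es

spanned-⊤ : (es : List (Subset n)) → spanned es ⊤ ≡ length es
spanned-⊤ es = cong length (filter-all (_⊆? ⊤) (All.universal ⊆-max es))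

Contains-refl : (G : Hypergraph k n) → G Contains G
Contains-refl G = id , id , λ e e∈ → subst (List._∈ edges G) (sym (image-id e)) e∈

-- `image f` sends the edges of `G` inside `s` injectively to edges of `H` inside `image f s`. This
-- is why sparsity passes to subgraphs.
spanned-image : {G : Hypergraph k m} {H : Hypergraph k n} ((f , _) : H Contains G) (s : Subset m) →
  spanned (edges G) s ≤ spanned (edges H) (image f s)
spanned-image {G = G} {H} (f , f-inj , f-edge) s = begin
  spanned (edges G) s                                      ≡⟨ length-map (image f) (filter (_⊆? s) (edges G)) ⟨
  length (map (image f) (filter (_⊆? s) (edges G)))        ≤⟨ Unique-⊆⇒length≤ images-unique incl ⟩
  spanned (edges H) (image f s)                            ∎
  where
  open ≤-Reasoning
  images-unique : Unique (map (image f) (filter (_⊆? s) (edges G)))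
  images-unique = Unique.map⁺ (image-injective f-inj) (Unique.filter⁺ (_⊆? s) (unique G))
  incl : ∀ {e} → e List.∈ map (image f) (filter (_⊆? s) (edges G)) →
         e List.∈ filter (_⊆? image f s) (edges H)
  incl e∈ with ∈-map⁻ (image f) e∈
  ... | e , e∈G , refl with ∈-filter⁻ (_⊆? s) {xs = edges G} e∈G
  ...   | e∈ , e⊆s = ∈-filter⁺ (_⊆? image f s) (f-edge e e∈) (image-mono f e⊆s)

-- Exhaustive search over finite hypergraphs.

allSubset? : {P : Pred (Subset n) 0ℓ} → Decidable P → Dec (∀ s → P s)
allSubset? P? = map′
  (λ ¬∃¬ s → decidable-stable (P? s) λ ¬p → ¬∃¬ (s , ¬p))
  (λ all (s , ¬p) → ¬p (all s))
  (¬? (anySubset? (¬? ∘ P?)))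

anyList? : ∀ e {P : Pred (List (Subset n)) 0ℓ} → Decidable P →
  Dec (Σ[ xs ∈ List (Subset n) ] length xs ≡ e × P xs)
anyList? zero P? = map′ (λ p → [] , refl , p) (λ { ([] , _ , p) → p }) (P? [])
anyList? (suc e) P? = map′
  (λ (x , xs , len , p) → x ∷ xs , cong suc len , p)
  (λ { (x ∷ xs , len , p) → x , xs , suc-injective len , p })
  (anySubset? λ x → anyList? e λ xs → P? (x ∷ xs))

_≟ˢ_ : DecidableEquality (Subset n)
_≟ˢ_ = Vec.≡-dec _≟ᵇ_

-- The search runs over edge lists, and the deciders supply the proofs of uniqueness and uniformity.
-- These may differ from the proofs carried by a given hypergraph, hence `resp`: `P` may depend on
-- the edges only.
anyHypergraph? : ∀ e {P : Pred (Hypergraph k n) 0ℓ} → Decidable P →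
  (∀ {G H} → edges G ≡ edges H → P G → P H) →
  Dec (Σ[ G ∈ Hypergraph k n ] P G × ∣E G ∣ ≡ e)
anyHypergraph? {k} {n} e {P} P? resp = map′
  (λ { (_ , len , u , v , p) → _ , p , len })
  (λ (G , p , len) → edges G , len , unique G , uniform G , resp refl p)
  (anyList? e ok?)
  where
  Ok : Pred (List (Subset n)) 0ℓ
  Ok es = Σ[ u ∈ Unique es ] Σ[ v ∈ All (λ e → ∣ e ∣ ≡ k) es ]
    P (record { edges = es ; unique = u ; uniform = v })
  ok? : Decidable Ok
  ok? es with unique? _≟ˢ_ es | All.all? (λ e → ∣ e ∣ ≟ k) es
  ... | no ¬u | _ = no λ (u , _) → ¬u u
  ... | yes _ | no ¬v = no λ (_ , v , _) → ¬v v
  ... | yes u | yes v = map′ (λ p → u , v , p) (λ (_ , _ , p) → resp refl p) (P? _)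

greatest : {P : Pred ℕ 0ℓ} → Decidable P → P 0 → ∀ b → (∀ e → P e → e ≤ b) →
  Σ[ e ∈ ℕ ] P e × (∀ e′ → P e′ → e′ ≤ e)
greatest P? p₀ zero bound = 0 , p₀ , bound
greatest P? p₀ (suc b) bound with P? (suc b)
... | yes p = suc b , p , bound
... | no ¬p = greatest P? p₀ b λ e p → ≤-pred (≤∧≢⇒< (bound e p) λ { refl → ¬p p })

-- The forbidden family and its extremal numbers.

module Sparsity (a q C : ℕ) .{{_ : NonZero q}} where

  -- Every set of m vertices spans at most C (1 + m) ^ (a / q) edges.
  Sparse : Hypergraph k n → Set
  Sparse G = ∀ s → spanned (edges G) s ^ q ≤ C ^ q * suc ∣ s ∣ ^ a

  sparse? : (G : Hypergraph k n) → Dec (Sparse G)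
  sparse? G = allSubset? λ s → _ ≤? _

  Dense : Family k
  Dense m G = ¬ Sparse G

  -- A dense hypergraph contains itself, a forbidden member; decidability of sparsity removes the
  -- double negation.
  Free⇒Sparse : (G : Hypergraph k n) → (Dense Free) G → Sparse G
  Free⇒Sparse G free = decidable-stable (sparse? G) λ ¬sparse → free _ G ¬sparse (Contains-refl G)

  -- For a set `s` in a subgraph `H`, the set `image f s` spans at least as many edges of `G` and
  -- has at most as many vertices, so `H` is sparse too.
  Sparse⇒Free : (G : Hypergraph k n) → Sparse G → (Dense Free) G
  Sparse⇒Free G sparse m H dense G⊇H@(f , _) = dense λ s → begin
    spanned (edges H) s ^ q           ≤⟨ ^-monoˡ-≤ q (spanned-image {G = H} {H = G} G⊇H s) ⟩
    spanned (edges G) (image f s) ^ q ≤⟨ sparse (image f s) ⟩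
    C ^ q * suc ∣ image f s ∣ ^ a     ≤⟨ *-monoʳ-≤ (C ^ q) (^-monoˡ-≤ a (s≤s (∣image∣≤ f _ s ≤-refl))) ⟩
    C ^ q * suc ∣ s ∣ ^ a             ∎
    where open ≤-Reasoning

  ∣E∣-bound : (G : Hypergraph k n) → Sparse G → ∣E G ∣ ^ q ≤ C ^ q * suc n ^ a
  ∣E∣-bound {n = n} G sparse =
    subst₂ (λ x y → x ^ q ≤ C ^ q * suc y ^ a) (spanned-⊤ (edges G)) (∣⊤∣≡n n) (sparse ⊤)

  m≤m^q : ∀ m → m ≤ m ^ q
  m≤m^q zero = z≤n
  m≤m^q m@(suc _) = ≤-trans (≤-reflexive (sym (^-identityʳ m))) (^-monoʳ-≤ m (>-nonZero⁻¹ q))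

  0^q≡0 : 0 ^ q ≡ 0
  0^q≡0 = pow q
    where
    pow : ∀ q .{{_ : NonZero q}} → 0 ^ q ≡ 0
    pow (suc q) = refl

  -- Since sparsity is decidable, so is the set of attained edge numbers. It contains 0 by the empty
  -- hypergraph and is bounded because `e ≤ e ^ q`, so it has a maximum.
  extremal : ∀ k n → Σ[ e ∈ ℕ ] IsEx {k} Dense n e
  extremal k n with greatest P? p₀ (C ^ q * suc n ^ a) bound
    where
    P : Pred ℕ 0ℓ
    P e = Σ[ G ∈ Hypergraph k n ] Sparse G × ∣E G ∣ ≡ e
    P? : Decidable P
    P? e = anyHypergraph? e sparse?
      (λ { {G} {H} eq p s → subst (λ es → spanned es s ^ q ≤ C ^ q * suc ∣ s ∣ ^ a) eq (p s)})
    p₀ : P 0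
    p₀ = record { edges = [] ; unique = [] ; uniform = [] } ,
      (λ s → subst (_≤ C ^ q * suc ∣ s ∣ ^ a) (sym 0^q≡0) z≤n) , refl
    bound : ∀ e → P e → e ≤ C ^ q * suc n ^ a
    bound e (G , sparse , refl) = ≤-trans (m≤m^q e) (∣E∣-bound G sparse)
  ... | e , (G , sparse , eq) , max = e , record
    { attained = G , Sparse⇒Free G sparse , eq
    ; maximal = λ H free → max _ (H , Free⇒Sparse H free , refl)
    }

-- Finite sums and derandomised selection from blocks.

∑ : List X → (X → ℕ) → ℕ
∑ xs f = sum (map f xs)

∑-cong : (xs : List X) {f g : X → ℕ} → (∀ x → f x ≡ g x) → ∑ xs f ≡ ∑ xs g
∑-cong [] f≗g = refl
∑-cong (x ∷ xs) f≗g = cong₂ _+_ (f≗g x) (∑-cong xs f≗g)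

∑-const-≤ : (xs : List X) {f : X → ℕ} {b : ℕ} → (∀ {x} → x List.∈ xs → f x ≤ b) →
  ∑ xs f ≤ length xs * b
∑-const-≤ [] f≤b = z≤n
∑-const-≤ (x ∷ xs) f≤b = +-mono-≤ (f≤b (here refl)) (∑-const-≤ xs λ x∈ → f≤b (there x∈))

∈⇒≤∑ : {xs : List X} (f : X → ℕ) {x : X} → x List.∈ xs → f x ≤ ∑ xs f
∈⇒≤∑ f (here refl) = m≤m+n _ _
∈⇒≤∑ f (there x∈) = m≤n⇒m≤o+n _ (∈⇒≤∑ f x∈)

∑-zero : (xs : List X) → ∑ xs (λ _ → 0) ≡ 0
∑-zero [] = refl
∑-zero (x ∷ xs) = ∑-zero xs

∑-+ : (xs : List X) (f g : X → ℕ) → ∑ xs (λ x → f x + g x) ≡ ∑ xs f + ∑ xs g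
∑-+ [] f g = refl
∑-+ (x ∷ xs) f g = trans (cong (f x + g x +_) (∑-+ xs f g)) (shuffle (f x) (g x) _ _)
  where
  shuffle : ∀ a b c d → a + b + (c + d) ≡ a + c + (b + d)
  shuffle = solve-∀

∑-swap : (xs : List X) (ys : List Y) (f : X → Y → ℕ) →
  ∑ xs (λ x → ∑ ys (f x)) ≡ ∑ ys (λ y → ∑ xs (λ x → f x y))
∑-swap [] ys f = sym (∑-zero ys)
∑-swap (x ∷ xs) ys f = trans (cong (∑ ys (f x) +_) (∑-swap xs ys f)) (sym (∑-+ ys (f x) _))

∑-* : (xs : List X) (f : X → ℕ) (a : ℕ) → ∑ xs f * a ≡ ∑ xs (λ x → f x * a)
∑-* [] f a = refl
∑-* (x ∷ xs) f a = trans (*-distribʳ-+ a (f x) _) (cong (f x * a +_) (∑-* xs f a))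

-- The induction keeps the smaller of the value at the head and the value found in the tail.
∃-below-average : (xs : List X) → .{{NonZero (length xs)}} → (f : X → ℕ) →
  ∃[ x ] x List.∈ xs × length xs * f x ≤ ∑ xs f
∃-below-average (x ∷ []) f = x , here refl , ≤-refl
∃-below-average (x ∷ xs@(_ ∷ _)) f with ∃-below-average xs f
... | y , y∈xs , below with f x ≤? f y
...   | yes fx≤fy = x , here refl ,
          +-monoʳ-≤ (f x) (≤-trans (*-monoʳ-≤ (length xs) fx≤fy) below)
...   | no fx≰fy = y , there y∈xs , +-mono-≤ (≰⇒≥ fx≰fy) below

-- The generating function Σ z ^ count ys over all ways of picking one element
-- from each of M consecutive blocks of length b of a list.
blockGF : {P : Pred X 0ℓ} → Decidable P → (z b M : ℕ) → List X → ℕ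
blockGF P? z b zero xs = 1
blockGF P? z b (suc M) xs = ∑ (take b xs) (λ x → z ^ count P? [ x ]) * blockGF P? z b M (drop b xs)

-- Method of conditional expectations: a below-average choice in each block keeps
-- the weighted sum below its expectation.
module _ {I : Set} (z : I → ℕ) {P : I → Pred X 0ℓ} (P? : ∀ t → Decidable (P t))
         (b : ℕ) .{{b≢0 : NonZero b}} where

  select : ∀ M xs → length xs ≡ M * b → (ts : List I) (w : I → ℕ) →
    Σ[ ys ∈ List X ] ys ⊑ xs × length ys ≡ M ×
      b ^ M * ∑ ts (λ t → w t * z t ^ count (P? t) ys) ≤ ∑ ts (λ t → w t * blockGF (P? t) (z t) b M xs)
  select zero xs len ts w = [] , Sublist.[]⊆-universal xs , refl , ≤-reflexive (*-identityˡ _)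
  select (suc M) xs len ts w = extend (∃-below-average block {{subst NonZero (sym block-length) b≢0}} potential)
    where
    block = take b xs
    rest = drop b xs
    block-length : length block ≡ b
    block-length = trans (length-take b xs) (m≤n⇒m⊓n≡m (≤-trans (m≤m+n b (M * b)) (≤-reflexive (sym len))))
    rest-length : length rest ≡ M * b
    rest-length = trans (length-drop b xs) (trans (cong (_∸ b) len) (m+n∸m≡n b (M * b)))
    -- The factor earned by the pick `x` moves into the weights, so that the recursive call sees the
    -- remaining blocks as a fresh instance.
    w′ : X → I → ℕ
    w′ x t = w t * z t ^ count (P? t) [ x ]
    -- Up to the factor `b ^ M`, the conditional expectation of the final sum given that `x` is
    -- picked.
    potential : X → ℕ
    potential x = ∑ ts (λ t → w′ x t * blockGF (P? t) (z t) b M rest)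
    average : ∑ block potential ≡ ∑ ts (λ t → w t * blockGF (P? t) (z t) b (suc M) xs)
    average = trans (sym (∑-swap ts block _)) (∑-cong ts λ t → sym (begin-equality
      w t * (∑ block (λ x → z t ^ count (P? t) [ x ]) * blockGF (P? t) (z t) b M rest)
        ≡⟨ cong (w t *_) (∑-* block _ _) ⟩
      w t * ∑ block (λ x → z t ^ count (P? t) [ x ] * blockGF (P? t) (z t) b M rest)
        ≡⟨ *-comm (w t) _ ⟩
      ∑ block (λ x → z t ^ count (P? t) [ x ] * blockGF (P? t) (z t) b M rest) * w t
        ≡⟨ ∑-* block _ (w t) ⟩
      ∑ block (λ x → z t ^ count (P? t) [ x ] * blockGF (P? t) (z t) b M rest * w t)
        ≡⟨ ∑-cong block (λ x → rotate (z t ^ count (P? t) [ x ]) _ (w t)) ⟩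
      ∑ block (λ x → w′ x t * blockGF (P? t) (z t) b M rest) ∎))
      where
      open ≤-Reasoning
      rotate : ∀ u v w → u * v * w ≡ w * u * v
      rotate = solve-∀
    extend : ∃[ x ] x List.∈ block × length block * potential x ≤ ∑ block potential → _
    extend (x , x∈block , below) with select M rest rest-length ts (w′ x)
    ... | ys , ys⊑rest , ys-length , bound =
      x ∷ ys ,
      subst (x ∷ ys ⊑_) (take++drop≡id b xs) (Sublist.++⁺ (from∈ x∈block) ys⊑rest) ,
      cong suc ys-length ,
      (begin
        b ^ suc M * ∑ ts (λ t → w t * z t ^ count (P? t) (x ∷ ys))
          ≡⟨ *-assoc b (b ^ M) _ ⟩
        b * (b ^ M * ∑ ts (λ t → w t * z t ^ count (P? t) (x ∷ ys)))
          ≡⟨ cong (λ s → b * (b ^ M * s)) (∑-cong ts λ t → split t) ⟩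
        b * (b ^ M * ∑ ts (λ t → w′ x t * z t ^ count (P? t) ys))
          ≤⟨ *-monoʳ-≤ b bound ⟩
        b * potential x
          ≡⟨ cong (_* potential x) block-length ⟨
        length block * potential x
          ≤⟨ below ⟩
        ∑ block potential
          ≡⟨ average ⟩
        ∑ ts (λ t → w t * blockGF (P? t) (z t) b (suc M) xs) ∎)
      where
      open ≤-Reasoning
      split : ∀ t → w t * z t ^ count (P? t) (x ∷ ys) ≡ w′ x t * z t ^ count (P? t) ys
      split t = trans (cong (w t *_) (trans (cong (z t ^_) (count-++ (P? t) [ x ] ys))
                                            (^-distribˡ-+-* (z t) (count (P? t) [ x ]) _)))
                      (sym (*-assoc (w t) _ _))

-- Integer forms of exponential inequalities.

^-distribʳ-* : ∀ m n o → (m * n) ^ o ≡ m ^ o * n ^ o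
^-distribʳ-* m n zero = refl
^-distribʳ-* m n (suc o) = trans (cong (m * n *_) (^-distribʳ-* m n o)) (swap m n _ _)
  where
  swap : ∀ a b c d → a * b * (c * d) ≡ a * c * (b * d)
  swap = solve-∀

-- Bernoulli's inequality (1 - 1/(T + 1)) ^ h ≥ 1 - h/(T + 1), cleared of fractions.
bernoulli : ∀ T h → suc T ^ suc h ≤ suc T * T ^ h + h * suc T ^ h
bernoulli T zero = ≤-reflexive (sym (+-identityʳ _))
bernoulli T (suc h) = begin
  suc T * suc T ^ suc h                                       ≡⟨⟩
  suc T ^ suc h + T * suc T ^ suc h                           ≤⟨ +-monoʳ-≤ (suc T ^ suc h) (*-monoʳ-≤ T (bernoulli T h)) ⟩
  suc T ^ suc h + T * (suc T * T ^ h + h * suc T ^ h)         ≡⟨ step T h (T ^ h) (suc T ^ h) ⟩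
  suc T * (T * T ^ h) + (suc T * suc T ^ h + h * (T * suc T ^ h))
    ≤⟨ +-monoʳ-≤ (suc T * (T * T ^ h)) (+-monoʳ-≤ (suc T * suc T ^ h) (*-monoʳ-≤ h (m≤n+m _ (suc T ^ h)))) ⟩
  suc T * T ^ suc h + suc h * suc T ^ suc h                   ∎
  where
  open ≤-Reasoning
  step : ∀ T h u v → suc T * v + T * (suc T * u + h * v) ≡ suc T * (T * u) + (suc T * v + h * (T * v))
  step = solve-∀

-- For h ≤ (T + 1)/2 Bernoulli's inequality gives (1 - 1/(T + 1)) ^ h ≥ 1/2.
halving : ∀ T h → 2 * h ≤ suc T → suc T ^ h ≤ 2 * T ^ h
halving T h 2h≤1+T = *-cancelˡ-≤ (suc T) (+-cancelʳ-≤ _ _ _ (begin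
  suc T * suc T ^ h + suc T * suc T ^ h                 ≡⟨ double (suc T * suc T ^ h) ⟩
  2 * suc T ^ suc h                                     ≤⟨ *-monoʳ-≤ 2 (bernoulli T h) ⟩
  2 * (suc T * T ^ h + h * suc T ^ h)                   ≡⟨ regroup T h (T ^ h) (suc T ^ h) ⟩
  suc T * (2 * T ^ h) + 2 * h * suc T ^ h               ≤⟨ +-monoʳ-≤ (suc T * (2 * T ^ h)) (*-monoˡ-≤ (suc T ^ h) 2h≤1+T) ⟩
  suc T * (2 * T ^ h) + suc T * suc T ^ h               ∎))
  where
  open ≤-Reasoning
  double : ∀ a → a + a ≡ 2 * a
  double = solve-∀
  regroup : ∀ T h u v → 2 * (suc T * u + h * v) ≡ suc T * (2 * u) + 2 * h * v
  regroup = solve-∀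

-- A substitute for (1 + 1/T) ^ T ≤ e. For even T, `halving` at h = T/2 is squared; T = 1 is checked
-- directly.
[1+T]^T≤4T^T : ∀ t → suc (2 ^ t) ^ 2 ^ t ≤ 4 * (2 ^ t) ^ 2 ^ t
[1+T]^T≤4T^T zero = s≤s (s≤s z≤n)
[1+T]^T≤4T^T (suc t) = begin
  suc T ^ (2 * h)             ≡⟨ cong (suc T ^_) (*-comm 2 h) ⟩
  suc T ^ (h * 2)             ≡⟨ ^-*-assoc (suc T) h 2 ⟨
  (suc T ^ h) ^ 2             ≤⟨ ^-monoˡ-≤ 2 (halving T h (n≤1+n T)) ⟩
  (2 * T ^ h) ^ 2             ≡⟨ ^-distribʳ-* 2 (T ^ h) 2 ⟩
  4 * (T ^ h) ^ 2             ≡⟨ cong (4 *_) (^-*-assoc T h 2) ⟩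
  4 * T ^ (h * 2)             ≡⟨ cong (λ e → 4 * T ^ e) (*-comm h 2) ⟩
  4 * T ^ (2 * h)             ∎
  where
  open ≤-Reasoning
  h = 2 ^ t
  T = 2 ^ suc t

-- The exponent `c` is padded to the multiple `2 ^ t * s`, where the previous bound can be raised to
-- the power `s`. The padding cancels because T ^ d ≤ (1 + T) ^ d.
[1+T]^c≤4^sT^c : ∀ t s c → c ≤ 2 ^ t * s → suc (2 ^ t) ^ c ≤ 4 ^ s * (2 ^ t) ^ c
[1+T]^c≤4^sT^c t s c c≤Ts = *-cancelʳ-≤ _ _ (T ^ d) {{m^n≢0 T d {{m^n≢0 2 t}}}} (begin
  suc T ^ c * T ^ d              ≤⟨ *-monoʳ-≤ (suc T ^ c) (^-monoˡ-≤ d (n≤1+n T)) ⟩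
  suc T ^ c * suc T ^ d          ≡⟨ ^-distribˡ-+-* (suc T) c d ⟨
  suc T ^ (c + d)                ≡⟨ cong (suc T ^_) c+d≡Ts ⟩
  suc T ^ (T * s)                ≡⟨ ^-*-assoc (suc T) T s ⟨
  (suc T ^ T) ^ s                ≤⟨ ^-monoˡ-≤ s ([1+T]^T≤4T^T t) ⟩
  (4 * T ^ T) ^ s                ≡⟨ ^-distribʳ-* 4 (T ^ T) s ⟩
  4 ^ s * (T ^ T) ^ s            ≡⟨ cong (4 ^ s *_) (^-*-assoc T T s) ⟩
  4 ^ s * T ^ (T * s)            ≡⟨ cong (λ e → 4 ^ s * T ^ e) c+d≡Ts ⟨
  4 ^ s * T ^ (c + d)            ≡⟨ cong (4 ^ s *_) (^-distribˡ-+-* T c d) ⟩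
  4 ^ s * (T ^ c * T ^ d)        ≡⟨ *-assoc (4 ^ s) (T ^ c) (T ^ d) ⟨
  4 ^ s * T ^ c * T ^ d          ∎)
  where
  open ≤-Reasoning
  T = 2 ^ t
  d = T * s ∸ c
  c+d≡Ts : c + d ≡ T * s
  c+d≡Ts = m+[n∸m]≡n c≤Ts

-- Bernoulli's inequality 1 + c/T ≤ (1 + 1/T) ^ c, multiplied by T ^ (c + 1). It plays the part of 1
-- + x ≤ exp x: the right side is multiplicative over blocks.
1+c/T≤[1+1/T]^c : ∀ T c → T ^ c * (T + c) ≤ T * suc T ^ c
1+c/T≤[1+1/T]^c T zero = ≤-reflexive (trans (*-identityˡ _) (trans (+-identityʳ T) (sym (*-identityʳ T))))
1+c/T≤[1+1/T]^c T (suc c) = begin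
  T * T ^ c * (T + suc c)               ≤⟨ m≤m+n _ (T ^ c * c) ⟩
  T * T ^ c * (T + suc c) + T ^ c * c   ≡⟨ regroup T c (T ^ c) ⟩
  suc T * (T ^ c * (T + c))             ≤⟨ *-monoʳ-≤ (suc T) (1+c/T≤[1+1/T]^c T c) ⟩
  suc T * (T * suc T ^ c)               ≡⟨ swap (suc T) T (suc T ^ c) ⟩
  T * (suc T * suc T ^ c)               ∎
  where
  open ≤-Reasoning
  regroup : ∀ T c u → T * u * (T + suc c) + u * c ≡ suc T * (u * (T + c))
  regroup = solve-∀
  swap : ∀ a b c → a * (b * c) ≡ b * (a * c)
  swap = solve-∀

-- Bounds on the block generating function.

module _ {P : Pred X 0ℓ} (P? : Decidable P) where

  ∑z^count≤ : ∀ z xs → ∑ xs (λ x → z ^ count P? [ x ]) ≤ length xs + z * count P? xs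
  ∑z^count≤ z [] = z≤n
  ∑z^count≤ z (x ∷ xs) with P? x
  ... | yes _ = begin
    z * 1 + ∑ xs (λ x → z ^ count P? [ x ]) ≤⟨ +-monoʳ-≤ (z * 1) (∑z^count≤ z xs) ⟩
    z * 1 + (length xs + z * count P? xs)   ≤⟨ n≤1+n _ ⟩
    suc (z * 1 + (length xs + z * count P? xs)) ≡⟨ regroup z (length xs) (count P? xs) ⟩
    suc (length xs) + z * suc (count P? xs) ∎
    where
    open ≤-Reasoning
    regroup : ∀ z l c → suc (z * 1 + (l + z * c)) ≡ suc l + z * suc c
    regroup = solve-∀
  ... | no _ = s≤s (∑z^count≤ z xs)

  -- With b = z T, a block with c hits sums to at most b + z c = b (1 + c/T) ≤ b (1 + 1/T) ^ c. In
  -- the product over all blocks the exponents c add up to the total count, however the hits are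
  -- distributed.
  blockGF≤ : ∀ z T M xs → T ^ count P? xs * blockGF P? z (z * T) M xs ≤ (z * T) ^ M * suc T ^ count P? xs
  blockGF≤ z T zero xs = begin
    T ^ count P? xs * 1           ≡⟨ *-identityʳ _ ⟩
    T ^ count P? xs               ≤⟨ ^-monoˡ-≤ (count P? xs) (n≤1+n T) ⟩
    suc T ^ count P? xs           ≡⟨ *-identityˡ _ ⟨
    1 * suc T ^ count P? xs       ∎
    where open ≤-Reasoning
  blockGF≤ z T (suc M) xs = begin
    T ^ count P? xs * (S * V)                         ≡⟨ cong (_* (S * V)) (split T) ⟩
    T ^ c * T ^ d * (S * V)                           ≡⟨ swap (T ^ c) (T ^ d) S V ⟩
    T ^ c * S * (T ^ d * V)                           ≤⟨ *-mono-≤ head (blockGF≤ z T M rest) ⟩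
    b * suc T ^ c * (b ^ M * suc T ^ d)               ≡⟨ swap b (suc T ^ c) (b ^ M) (suc T ^ d) ⟩
    b ^ suc M * (suc T ^ c * suc T ^ d)               ≡⟨ cong (b ^ suc M *_) (split (suc T)) ⟨
    b ^ suc M * suc T ^ count P? xs                   ∎
    where
    open ≤-Reasoning
    b = z * T
    block = take b xs
    rest = drop b xs
    c = count P? block
    d = count P? rest
    S = ∑ block (λ x → z ^ count P? [ x ])
    V = blockGF P? z b M rest
    swap : ∀ a b c d → a * b * (c * d) ≡ a * c * (b * d)
    swap = solve-∀
    split : ∀ u → u ^ count P? xs ≡ u ^ c * u ^ d
    split u = trans (cong (u ^_) (trans (cong (count P?) (sym (take++drop≡id b xs))) (count-++ P? block rest)))
                    (^-distribˡ-+-* u c d)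
    head : T ^ c * S ≤ b * suc T ^ c
    head = begin
      T ^ c * S                     ≤⟨ *-monoʳ-≤ (T ^ c) (∑z^count≤ z block) ⟩
      T ^ c * (length block + z * c)
        ≤⟨ *-monoʳ-≤ (T ^ c) (+-monoˡ-≤ (z * c) (≤-trans (≤-reflexive (length-take b xs)) (m⊓n≤m b _))) ⟩
      T ^ c * (z * T + z * c)       ≡⟨ regroup z T c (T ^ c) ⟩
      z * (T ^ c * (T + c))         ≤⟨ *-monoʳ-≤ z (1+c/T≤[1+1/T]^c T c) ⟩
      z * (T * suc T ^ c)           ≡⟨ *-assoc z T _ ⟨
      b * suc T ^ c                 ∎
      where
      regroup : ∀ z T c u → u * (z * T + z * c) ≡ z * (u * (T + c))
      regroup = solve-∀

  -- The bound E z ^ X ≤ exp (m ^ α), with 4 in place of e and `s` in place of m ^ α. Here T = b / z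
  -- is a power of two, as the estimate by powers of 4 asks.
  blockGF≤b^M*4^s : ∀ z t s M xs → count P? xs ≤ 2 ^ t * s →
    blockGF P? z (z * 2 ^ t) M xs ≤ (z * 2 ^ t) ^ M * 4 ^ s
  blockGF≤b^M*4^s z t s M xs c≤Ts = *-cancelˡ-≤ (T ^ c) {{m^n≢0 T c {{m^n≢0 2 t}}}} (begin
    T ^ c * blockGF P? z (z * T) M xs ≤⟨ blockGF≤ z T M xs ⟩
    (z * T) ^ M * suc T ^ c           ≤⟨ *-monoʳ-≤ ((z * T) ^ M) ([1+T]^c≤4^sT^c t s c c≤Ts) ⟩
    (z * T) ^ M * (4 ^ s * T ^ c)     ≡⟨ regroup ((z * T) ^ M) (4 ^ s) (T ^ c) ⟩
    T ^ c * ((z * T) ^ M * 4 ^ s)     ∎)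
    where
    open ≤-Reasoning
    T = 2 ^ t
    c = count P? xs
    regroup : ∀ a b c → a * (b * c) ≡ c * (a * b)
    regroup = solve-∀

-- Counting in products and the complete partite hypergraph.

length-cartesianProductWith : (f : X → Y → Z) (xs : List X) (ys : List Y) →
  length (cartesianProductWith f xs ys) ≡ length xs * length ys
length-cartesianProductWith f [] ys = refl
length-cartesianProductWith f (x ∷ xs) ys = trans (length-++ (map (f x) ys))
  (cong₂ _+_ (length-map (f x) ys) (length-cartesianProductWith f xs ys))

count-map : {P : Pred Y 0ℓ} {Q : Pred X 0ℓ} (P? : Decidable P) (Q? : Decidable Q) (f : X → Y) →
  (∀ {x} → P (f x) → Q x) → ∀ xs → count P? (map f xs) ≤ count Q? xs
count-map P? Q? f P⇒Q [] = z≤n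
count-map P? Q? f P⇒Q (x ∷ xs) with P? (f x) | Q? x
... | yes _ | yes _ = s≤s (count-map P? Q? f P⇒Q xs)
... | yes p | no ¬q = contradiction (P⇒Q p) ¬q
... | no _ | yes _ = m≤n⇒m≤1+n (count-map P? Q? f P⇒Q xs)
... | no _ | no _ = count-map P? Q? f P⇒Q xs

count-mono : {P Q : Pred X 0ℓ} (P? : Decidable P) (Q? : Decidable Q) → (∀ {x} → P x → Q x) →
  ∀ xs → count P? xs ≤ count Q? xs
count-mono P? Q? P⊆Q xs = subst (λ ys → count P? ys ≤ count Q? xs) (map-id xs) (count-map P? Q? id P⊆Q xs)

count-cartesianProductWith : {P : Pred X 0ℓ} {Q : Pred Y 0ℓ} {R : Pred Z 0ℓ}
  (P? : Decidable P) (Q? : Decidable Q) (R? : Decidable R) (f : X → Y → Z) →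
  (∀ {x y} → R (f x y) → P x × Q y) → ∀ xs ys →
  count R? (cartesianProductWith f xs ys) ≤ count P? xs * count Q? ys
count-cartesianProductWith P? Q? R? f R⇒ [] ys = z≤n
count-cartesianProductWith P? Q? R? f R⇒ (x ∷ xs) ys with P? x
... | yes _ = ≤-trans (≤-reflexive (count-++ R? (map (f x) ys) _))
        (+-mono-≤ (count-map R? Q? (f x) (proj₂ ∘ R⇒) ys) (count-cartesianProductWith P? Q? R? f R⇒ xs ys))
... | no ¬p = ≤-trans (≤-reflexive (trans (count-++ R? (map (f x) ys) _)
        (cong (λ zs → length zs + count R? (cartesianProductWith f xs ys))
              (filter-none R? (All.map⁺ (All.universal (λ _ → ¬p ∘ proj₁ ∘ R⇒) ys))))))
        (count-cartesianProductWith P? Q? R? f R⇒ xs ys)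

Unique⇒length≤∣∣ : (s : Subset n) {xs : List (Fin n)} → Unique xs → All (_∈ s) xs → length xs ≤ ∣ s ∣
Unique⇒length≤∣∣ s [] [] = z≤n
Unique⇒length≤∣∣ s {x ∷ xs} (x∉xs ∷ xs!) (x∈s ∷ xs⊆s) = ≤-trans
  (s≤s (Unique⇒length≤∣∣ (s - x) xs! (All.zipWith (λ (x≢y , y∈s) → x∈p∧x≢y⇒x∈p-y y∈s (≢-sym x≢y)) (x∉xs , xs⊆s))))
  (x∈p⇒∣p-x∣<∣p∣ x∈s)

count-∈ : (s : Subset n) → count (_∈? s) (allFin n) ≤ ∣ s ∣
count-∈ {n} s = Unique⇒length≤∣∣ s (Unique.filter⁺ (_∈? s) (Unique.allFin⁺ n)) (All.all-filter (_∈? s) (allFin n))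

∣++∣ : (p : Subset m) (q : Subset n) → ∣ p Vec.++ q ∣ ≡ ∣ p ∣ + ∣ q ∣
∣++∣ [] q = refl
∣++∣ (inside ∷ p) q = cong suc (∣++∣ p q)
∣++∣ (outside ∷ p) q = ∣++∣ p q

∈-++ˡ : {p : Subset m} {q : Subset n} {x : Fin m} → x ∈ p → x Fin.↑ˡ n ∈ p Vec.++ q
∈-++ˡ {p = p} {q} {x} x∈p = Vec.lookup⇒[]= _ _ (trans (Vec.lookup-++ˡ p q x) (Vec.[]=⇒lookup x∈p))

∈-++ˡ⁻ : (p : Subset m) {q : Subset n} {x : Fin m} → x Fin.↑ˡ n ∈ p Vec.++ q → x ∈ p
∈-++ˡ⁻ p {q} {x} x∈ = Vec.lookup⇒[]= _ _ (trans (sym (Vec.lookup-++ˡ p q x)) (Vec.[]=⇒lookup x∈))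

⊆-++ʳ⁻ : (p p′ : Subset m) {q q′ : Subset n} → p Vec.++ q ⊆ p′ Vec.++ q′ → q ⊆ q′
⊆-++ʳ⁻ [] [] incl = incl
⊆-++ʳ⁻ (_ ∷ p) (_ ∷ p′) incl = ⊆-++ʳ⁻ p p′ (drop-∷-⊆ incl)

-- The complete k-partite k-hypergraph with parts of size N, and d isolated vertices.
module Partite (N d : ℕ) where

  -- With this recursion `join` typechecks by computation, without transport along `order≡`.
  order : ℕ → ℕ
  order zero = d
  order (suc k) = N + order k

  order≡ : ∀ k → order k ≡ k * N + d
  order≡ zero = refl
  order≡ (suc k) = trans (cong (N +_) (order≡ k)) (sym (+-assoc N (k * N) d))

  join : Fin N → Subset (order k) → Subset (order (suc k))
  join x e = ⁅ x ⁆ Vec.++ e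

  transversals : ∀ k → List (Subset (order k))
  transversals zero = [ ⊥ ]
  transversals (suc k) = cartesianProductWith (join {k}) (allFin N) (transversals k)

  length-transversals : ∀ k → length (transversals k) ≡ N ^ k
  length-transversals zero = refl
  length-transversals (suc k) = trans (length-cartesianProductWith (join {k}) (allFin N) (transversals k))
    (cong₂ _*_ (length-tabulate {n = N} id) (length-transversals k))

  join-injective : ∀ {x y} {e f : Subset (order k)} → join {k} x e ≡ join {k} y f → x ≡ y × e ≡ f
  join-injective {x = x} {y} eq with Vec.++-injective ⁅ x ⁆ ⁅ y ⁆ eq
  ... | ⁅x⁆≡⁅y⁆ , e≡f = x∈⁅y⁆⇒x≡y y (subst (x ∈_) ⁅x⁆≡⁅y⁆ (x∈⁅x⁆ x)) , e≡f

  transversals-unique : ∀ k → Unique (transversals k)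
  transversals-unique zero = [] ∷ []
  transversals-unique (suc k) = Unique.cartesianProductWith⁺ (join {k}) (join-injective {k})
    (Unique.allFin⁺ N) (transversals-unique k)

  transversals-uniform : ∀ k → All (λ e → ∣ e ∣ ≡ k) (transversals k)
  transversals-uniform zero = ∣⊥∣≡0 d ∷ []
  transversals-uniform (suc k) = All.cartesianProductWith⁺ (setoid _) (setoid _) (join {k})
    (allFin N) (transversals k)
    λ {x} {e} _ e∈ → trans (∣++∣ ⁅ x ⁆ e) (cong₂ _+_ (∣⁅x⁆∣≡1 x) (All.lookup (transversals-uniform k) e∈))

  -- An edge inside p ++ q is a vertex of `p` joined to a smaller transversal inside `q`, so the
  -- counts multiply.
  spanned-transversals : ∀ k (s : Subset (order k)) → spanned (transversals k) s ≤ ∣ s ∣ ^ k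
  spanned-transversals zero s with ⊥ ⊆? s
  ... | yes _ = ≤-refl
  ... | no _ = z≤n
  spanned-transversals (suc k) s with Vec.splitAt N s
  ... | p , q , refl = begin
    spanned (transversals (suc k)) (p Vec.++ q)
      ≤⟨ count-cartesianProductWith (_∈? p) (_⊆? q) (_⊆? (p Vec.++ q)) (join {k}) inside-parts
           (allFin N) (transversals k) ⟩
    count (_∈? p) (allFin N) * spanned (transversals k) q
      ≤⟨ *-mono-≤ (count-∈ p) (spanned-transversals k q) ⟩
    ∣ p ∣ * ∣ q ∣ ^ k
      ≤⟨ *-mono-≤ (m≤m+n ∣ p ∣ ∣ q ∣) (^-monoˡ-≤ k (m≤n+m ∣ q ∣ ∣ p ∣)) ⟩
    (∣ p ∣ + ∣ q ∣) ^ suc k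
      ≡⟨ cong (_^ suc k) (∣++∣ p q) ⟨
    ∣ p Vec.++ q ∣ ^ suc k ∎
    where
    open ≤-Reasoning
    inside-parts : ∀ {x e} → join {k} x e ⊆ p Vec.++ q → x ∈ p × e ⊆ q
    inside-parts {x} {e} incl = ∈-++ˡ⁻ p (incl (∈-++ˡ (x∈⁅x⁆ x))) , ⊆-++ʳ⁻ ⁅ x ⁆ p incl

-- Covering small vertex sets by a short list.

-- Entries are indexed by words of length `m`, repetitions included, so the length is exactly n ^ m,
-- the number used in the union bound.
smallSubsets : ∀ n → ℕ → List (Subset n)
smallSubsets n zero = [ ⊥ ]
smallSubsets n (suc m) = cartesianProductWith (λ x s → s ∪ ⁅ x ⁆) (allFin n) (smallSubsets n m)

length-smallSubsets : ∀ n m → length (smallSubsets n m) ≡ n ^ m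
length-smallSubsets n zero = refl
length-smallSubsets n (suc m) = trans (length-cartesianProductWith _ (allFin n) (smallSubsets n m))
  (cong₂ _*_ (length-tabulate {n = n} id) (length-smallSubsets n m))

smallSubsets-small : ∀ n m → All (λ s → ∣ s ∣ ≤ m) (smallSubsets n m)
smallSubsets-small n zero = ≤-reflexive (∣⊥∣≡0 n) ∷ []
smallSubsets-small n (suc m) = All.cartesianProductWith⁺ (setoid _) (setoid _) _ (allFin n) (smallSubsets n m)
  λ {x} {s} _ s∈ → ≤-trans (∣p∪⁅x⁆∣≤1+∣p∣ s x) (s≤s (All.lookup (smallSubsets-small n m) s∈))

-- One point of `s` is peeled off per letter. When `s` is exhausted early, the remaining letters are
-- filled with the vertex `zero`, so only a superset is obtained.
∃-smallSuperset : .{{NonZero n}} → ∀ m (s : Subset n) → ∣ s ∣ ≤ m → ∃[ t ] t List.∈ smallSubsets n m × s ⊆ t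
∃-smallSuperset m s ∣s∣≤m with nonempty? s
∃-smallSuperset {suc n} zero s ∣s∣≤0 | no s-empty = ⊥ , here refl , λ x∈s → contradiction (_ , x∈s) s-empty
∃-smallSuperset {suc n} (suc m) s _ | no s-empty
  with ∃-smallSuperset m (⊥ {suc n}) (≤-trans (≤-reflexive (∣⊥∣≡0 n)) z≤n)
... | t , t∈ , _ = t ∪ ⁅ zero ⁆ ,
  ∈-cartesianProductWith⁺ (λ x s → s ∪ ⁅ x ⁆) (∈-allFin zero) t∈ ,
  λ x∈s → contradiction (_ , x∈s) s-empty
∃-smallSuperset zero s ∣s∣≤0 | yes (x , x∈s) = contradiction (<-≤-trans (x∈p⇒∣p-x∣<∣p∣ x∈s) ∣s∣≤0) λ ()
∃-smallSuperset (suc m) s ∣s∣≤1+m | yes (x , x∈s)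
  with ∃-smallSuperset m (s - x) (≤-pred (≤-trans (x∈p⇒∣p-x∣<∣p∣ x∈s) ∣s∣≤1+m))
... | t , t∈ , s-x⊆t = t ∪ ⁅ x ⁆ , ∈-cartesianProductWith⁺ (λ x s → s ∪ ⁅ x ⁆) (∈-allFin x) t∈ ,
  λ y∈s → x∈p∪q⁺ ([ inj₁ ∘ s-x⊆t , inj₂ ]′ (x∈p∪q⁻ (s - x) ⁅ x ⁆ (p⊆p-x∪⁅x⁆ s x y∈s)))

-- Thinning a hypergraph to a prescribed density.

n<2^n : ∀ n → n < 2 ^ n
n<2^n zero = s≤s z≤n
n<2^n (suc n) = begin-strict
  suc n             <⟨ s≤s (n<2^n n) ⟩
  suc (2 ^ n)       ≤⟨ +-monoˡ-≤ (2 ^ n) (m^n>0 2 n) ⟩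
  2 ^ n + 2 ^ n     ≡⟨ cong (2 ^ n +_) (+-identityʳ (2 ^ n)) ⟨
  2 ^ suc n         ∎
  where open ≤-Reasoning

2^-cancel-≤ : ∀ m n → 2 ^ m ≤ 2 ^ n → m ≤ n
2^-cancel-≤ m n le with m ≤? n
... | yes m≤n = m≤n
... | no m≰n = contradiction le (<⇒≱ (^-monoʳ-< 2 (s≤s (s≤s z≤n)) (≰⇒> m≰n)))

-- Here `r` and `a` are numerators over `q`: with N = 2 ^ (q L) there are M = N ^ (a/q) blocks of
-- size b = N ^ (r/q). The bound on `n` is guarded by `0 < L` because at L = 0 it would force n ≤ 1;
-- the list of tests is empty then.
module Thinning
  {n k q a r D L : ℕ} .{{_ : NonZero n}} .{{_ : NonZero r}} (xs : List (Subset n))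
  (r+a≡kq : r + a ≡ k * q) (q<a : q < a) (n≤ : 0 < L → n ≤ 2 ^ (D * L))
  (len : length xs ≡ 2 ^ (a * L) * 2 ^ (r * L))
  (spanned-xs : ∀ s → spanned xs s ≤ ∣ s ∣ ^ k)
  where

  M b : ℕ
  M = 2 ^ (a * L)
  b = 2 ^ (r * L)

  b≢0 : NonZero b
  b≢0 = m^n≢0 2 (r * L)

  -- 2 ^ cost j bounds the number of sets tested at level j times the factor
  -- 4 ^ s of blockGF≤b^M*4^s.
  cost : ℕ → ℕ
  cost j = D * L * 2 ^ (q * j) + 2 * 2 ^ (a * j)

  cost-mono : ∀ {i j} → i ≤ j → cost i ≤ cost j
  cost-mono i≤j = +-mono-≤ (*-monoʳ-≤ (D * L) (^-monoʳ-≤ 2 (*-monoʳ-≤ q i≤j)))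
                           (*-monoʳ-≤ 2 (^-monoʳ-≤ 2 (*-monoʳ-≤ a i≤j)))

  tests : ℕ → List (ℕ × Subset n)
  tests zero = []
  tests (suc l) = map (l ,_) (smallSubsets n (2 ^ (q * l))) ++ tests l

  ∈-tests : ∀ {l j s} → j < l → s List.∈ smallSubsets n (2 ^ (q * j)) → (j , s) List.∈ tests l
  ∈-tests {suc l} {j} (s≤s j≤l) s∈ with m≤n⇒m<n∨m≡n j≤l
  ... | inj₁ j<l = ∈-++⁺ʳ (map (l ,_) (smallSubsets n (2 ^ (q * l)))) (∈-tests j<l s∈)
  ... | inj₂ refl = ∈-++⁺ˡ (∈-map⁺ (l ,_) s∈)

  -- At scale m = 2 ^ (q j), `base` is z = (N / m) ^ (r/q). The weights bring all levels to the same
  -- bound `b ^ M * 2 ^ cost L`.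
  base weight : ℕ × Subset n → ℕ
  base (j , _) = 2 ^ (r * (L ∸ j))
  weight (j , _) = 2 ^ (cost L ∸ cost j)

  inside? = λ (t : ℕ × Subset n) → _⊆? proj₂ t

  initial : ℕ × Subset n → ℕ
  initial t = weight t * blockGF (inside? t) (base t) b M xs

  -- Puts `b` into the form z T, with T = m ^ (r/q), that `blockGF≤b^M*4^s` asks for.
  base*T≡b : ∀ {j} → j ≤ L → 2 ^ (r * (L ∸ j)) * 2 ^ (r * j) ≡ b
  base*T≡b {j} j≤L = begin
    2 ^ (r * (L ∸ j)) * 2 ^ (r * j) ≡⟨ ^-distribˡ-+-* 2 (r * (L ∸ j)) (r * j) ⟨
    2 ^ (r * (L ∸ j) + r * j)       ≡⟨ cong (2 ^_) (*-distribˡ-+ r (L ∸ j) j) ⟨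
    2 ^ (r * (L ∸ j + j))           ≡⟨ cong (λ l → 2 ^ (r * l)) (m∸n+n≡m j≤L) ⟩
    b                               ∎
    where open ≡-Reasoning

  -- m ^ k = m ^ (r/q) * m ^ (a/q), since r + a = k q.
  spanned≤T*s : ∀ j s → ∣ s ∣ ≤ 2 ^ (q * j) → spanned xs s ≤ 2 ^ (r * j) * 2 ^ (a * j)
  spanned≤T*s j s ∣s∣≤ = begin
    spanned xs s                ≤⟨ spanned-xs s ⟩
    ∣ s ∣ ^ k                   ≤⟨ ^-monoˡ-≤ k ∣s∣≤ ⟩
    (2 ^ (q * j)) ^ k           ≡⟨ ^-*-assoc 2 (q * j) k ⟩
    2 ^ (q * j * k)             ≡⟨ cong (2 ^_) (rotate q j k) ⟩
    2 ^ (k * q * j)             ≡⟨ cong (λ e → 2 ^ (e * j)) r+a≡kq ⟨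
    2 ^ ((r + a) * j)           ≡⟨ cong (2 ^_) (*-distribʳ-+ j r a) ⟩
    2 ^ (r * j + a * j)         ≡⟨ ^-distribˡ-+-* 2 (r * j) (a * j) ⟩
    2 ^ (r * j) * 2 ^ (a * j)   ∎
    where
    open ≤-Reasoning
    rotate : ∀ q j k → q * j * k ≡ k * q * j
    rotate = solve-∀

  initial≤ : ∀ {j} s → j < L → ∣ s ∣ ≤ 2 ^ (q * j) →
    initial (j , s) ≤ 2 ^ (cost L ∸ cost j) * (b ^ M * 4 ^ 2 ^ (a * j))
  initial≤ {j} s j<L ∣s∣≤ = *-monoʳ-≤ (weight (j , s))
    (subst (λ b → blockGF (_⊆? s) (base (j , s)) b M xs ≤ b ^ M * 4 ^ 2 ^ (a * j)) (base*T≡b (<⇒≤ j<L))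
      (blockGF≤b^M*4^s (_⊆? s) (base (j , s)) (r * j) (2 ^ (a * j)) M xs (spanned≤T*s j s ∣s∣≤)))

  -- The union bound at scale m: n ^ m sets with a factor 4 ^ (m ^ (a/q)) each amount to at most 2 ^
  -- cost j, which the weight completes to 2 ^ cost L.
  level≤ : ∀ {j} → j < L → ∑ (map (j ,_) (smallSubsets n (2 ^ (q * j)))) initial ≤ b ^ M * 2 ^ cost L
  level≤ {j} j<L = begin
    ∑ (map (j ,_) small) initial
      ≡⟨ cong sum (map-∘ {g = initial} {f = j ,_} small) ⟨
    ∑ small (λ s → initial (j , s))
      ≤⟨ ∑-const-≤ small (λ {s} s∈ → initial≤ s j<L (All.lookup (smallSubsets-small n μ) s∈)) ⟩
    length small * (2 ^ e * (b ^ M * 4 ^ 2 ^ (a * j)))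
      ≡⟨ cong (_* (2 ^ e * (b ^ M * 4 ^ 2 ^ (a * j)))) (length-smallSubsets n μ) ⟩
    n ^ μ * (2 ^ e * (b ^ M * 4 ^ 2 ^ (a * j)))
      ≤⟨ *-monoˡ-≤ _ (^-monoˡ-≤ μ (n≤ (m<n⇒0<n j<L))) ⟩
    (2 ^ (D * L)) ^ μ * (2 ^ e * (b ^ M * 4 ^ 2 ^ (a * j)))
      ≡⟨ cong₂ (λ u v → u * (2 ^ e * (b ^ M * v))) (^-*-assoc 2 (D * L) μ) (^-*-assoc 2 2 (2 ^ (a * j))) ⟩
    2 ^ (D * L * μ) * (2 ^ e * (b ^ M * 2 ^ (2 * 2 ^ (a * j))))
      ≡⟨ regroup (2 ^ (D * L * μ)) (2 ^ e) (b ^ M) (2 ^ (2 * 2 ^ (a * j))) ⟩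
    b ^ M * (2 ^ e * (2 ^ (D * L * μ) * 2 ^ (2 * 2 ^ (a * j))))
      ≡⟨ cong (λ u → b ^ M * (2 ^ e * u)) (^-distribˡ-+-* 2 (D * L * μ) (2 * 2 ^ (a * j))) ⟨
    b ^ M * (2 ^ e * 2 ^ cost j)
      ≡⟨ cong (b ^ M *_) (^-distribˡ-+-* 2 e (cost j)) ⟨
    b ^ M * 2 ^ (e + cost j)
      ≡⟨ cong (λ u → b ^ M * 2 ^ u) (m∸n+n≡m (cost-mono (<⇒≤ j<L))) ⟩
    b ^ M * 2 ^ cost L ∎
    where
    open ≤-Reasoning
    μ = 2 ^ (q * j)
    e = cost L ∸ cost j
    small = smallSubsets n μ
    regroup : ∀ u v w x → u * (v * (w * x)) ≡ w * (v * (u * x))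
    regroup = solve-∀

  ∑initial≤ : ∀ l → l ≤ L → ∑ (tests l) initial ≤ l * (b ^ M * 2 ^ cost L)
  ∑initial≤ zero _ = z≤n
  ∑initial≤ (suc l) l<L = begin
    ∑ (level ++ tests l) initial             ≡⟨ cong sum (map-++ initial level (tests l)) ⟩
    sum (map initial level ++ map initial (tests l)) ≡⟨ sum-++ (map initial level) _ ⟩
    ∑ level initial + ∑ (tests l) initial    ≤⟨ +-mono-≤ (level≤ l<L) (∑initial≤ l (<⇒≤ l<L)) ⟩
    suc l * (b ^ M * 2 ^ cost L)             ∎
    where
    open ≤-Reasoning
    level = map (l ,_) (smallSubsets n (2 ^ (q * l)))

  -- The exponent inequality 2 ^ (r (L - j) c) ≤ L 2 ^ cost j forces c = O(2 ^ (a j)),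
  -- because L ≤ (j + 1) (L - j) for j < L.
  solve-count : ∀ {j} c → j < L → r * (L ∸ j) * c ≤ L + cost j → c ≤ (D + 3) * 2 ^ (a * j)
  solve-count {j} c j<L le = *-cancelˡ-≤ d {{d≢0}} (begin
    d * c                                             ≤⟨ m≤n*m (d * c) r ⟩
    r * (d * c)                                       ≡⟨ *-assoc r d c ⟨
    r * d * c                                         ≤⟨ le ⟩
    L + (D * L * u + 2 * s)                           ≤⟨ +-mono-≤ L≤ (+-mono-≤ (*-monoˡ-≤ u (*-monoʳ-≤ D L≤)) (m≤n*m (2 * s) d {{d≢0}})) ⟩
    suc j * d + (D * (suc j * d) * u + d * (2 * s))   ≡⟨ regroup (suc j) d D u s ⟩
    d * (suc j + D * (suc j * u) + 2 * s)             ≤⟨ *-monoʳ-≤ d (+-monoˡ-≤ (2 * s) (+-mono-≤ 1+j≤s (*-monoʳ-≤ D [1+j]u≤s))) ⟩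
    d * (s + D * s + 2 * s)                           ≡⟨ cong (d *_) (collect D s) ⟩
    d * ((D + 3) * s)                                 ∎)
    where
    open ≤-Reasoning
    d = L ∸ j
    u = 2 ^ (q * j)
    s = 2 ^ (a * j)
    d≢0 : NonZero d
    d≢0 = >-nonZero (m<n⇒0<n∸m j<L)
    L≤ : L ≤ suc j * d
    L≤ = begin
      L           ≡⟨ m∸n+n≡m (<⇒≤ j<L) ⟨
      d + j       ≤⟨ +-monoʳ-≤ d (m≤m*n j d {{d≢0}}) ⟩
      suc j * d   ∎
    -- Here α > 1 enters: q + 1 ≤ a absorbs the factor j + 1 ≤ 2 ^ j.
    [1+j]u≤s : suc j * u ≤ s
    [1+j]u≤s = begin
      suc j * u                 ≤⟨ *-monoˡ-≤ u (n<2^n j) ⟩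
      2 ^ j * 2 ^ (q * j)       ≡⟨ ^-distribˡ-+-* 2 j (q * j) ⟨
      2 ^ (suc q * j)           ≤⟨ ^-monoʳ-≤ 2 (*-monoˡ-≤ j q<a) ⟩
      s                         ∎
    1+j≤s : suc j ≤ s
    1+j≤s = ≤-trans (m≤m*n (suc j) u {{m^n≢0 2 (q * j)}}) [1+j]u≤s
    regroup : ∀ i d D u s → i * d + (D * (i * d) * u + d * (2 * s)) ≡ d * (i + D * (i * u) + 2 * s)
    regroup = solve-∀
    collect : ∀ D s → s + D * s + 2 * s ≡ (D + 3) * s
    collect = solve-∀

  -- A sum of naturals bounds each of its terms, so the one bound on the weighted sum controls all
  -- tests at once. A general set is covered by a test set of its level.
  thin : Σ[ ys ∈ List (Subset n) ] ys ⊑ xs × length ys ≡ 2 ^ (a * L) ×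
    (∀ j s → ∣ s ∣ ≤ 2 ^ (q * j) → spanned ys s ≤ (D + 3) * 2 ^ (a * j))
  thin with select base inside? b {{b≢0}} M xs len (tests L) weight
  ... | ys , ys⊑xs , ys-length , bound = ys , ys⊑xs , ys-length , sparse
    where
    open ≤-Reasoning
    final : ℕ × Subset n → ℕ
    final t = weight t * base t ^ spanned ys (proj₂ t)
    ∑final≤ : ∑ (tests L) final ≤ L * 2 ^ cost L
    ∑final≤ = *-cancelˡ-≤ (b ^ M) {{m^n≢0 b M {{b≢0}}}} (begin
      b ^ M * ∑ (tests L) final     ≤⟨ bound ⟩
      ∑ (tests L) initial           ≤⟨ ∑initial≤ L ≤-refl ⟩
      L * (b ^ M * 2 ^ cost L)      ≡⟨ swap L (b ^ M) (2 ^ cost L) ⟩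
      b ^ M * (L * 2 ^ cost L)      ∎)
      where
      swap : ∀ x y z → x * (y * z) ≡ y * (x * z)
      swap = solve-∀
    exponents : ∀ {j} t → j < L → t List.∈ smallSubsets n (2 ^ (q * j)) →
      r * (L ∸ j) * spanned ys t ≤ L + cost j
    exponents {j} t j<L t∈ = +-cancelˡ-≤ e _ _ (2^-cancel-≤ _ _ (begin
      2 ^ (e + r * (L ∸ j) * c)        ≡⟨ ^-distribˡ-+-* 2 e _ ⟩
      2 ^ e * 2 ^ (r * (L ∸ j) * c)    ≡⟨ cong (2 ^ e *_) (^-*-assoc 2 (r * (L ∸ j)) c) ⟨
      final (j , t)                    ≤⟨ ∈⇒≤∑ final (∈-tests j<L t∈) ⟩
      ∑ (tests L) final                ≤⟨ ∑final≤ ⟩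
      L * 2 ^ cost L                   ≤⟨ *-monoˡ-≤ (2 ^ cost L) (<⇒≤ (n<2^n L)) ⟩
      2 ^ L * 2 ^ cost L               ≡⟨ ^-distribˡ-+-* 2 L (cost L) ⟨
      2 ^ (L + cost L)                 ≡⟨ cong (λ x → 2 ^ (L + x)) (m∸n+n≡m (cost-mono (<⇒≤ j<L))) ⟨
      2 ^ (L + (e + cost j))           ≡⟨ cong (2 ^_) (swap L e (cost j)) ⟩
      2 ^ (e + (L + cost j))           ∎))
      where
      e = cost L ∸ cost j
      c = spanned ys t
      swap : ∀ x y z → x + (y + z) ≡ y + (x + z)
      swap = solve-∀
    sparse : ∀ j s → ∣ s ∣ ≤ 2 ^ (q * j) → spanned ys s ≤ (D + 3) * 2 ^ (a * j)
    sparse j s ∣s∣≤ with j <? L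
    -- Levels from `L` on are not tested: there even the total number of edges, 2 ^ (a L), is within
    -- the bound.
    ... | no j≮L = begin
      spanned ys s            ≤⟨ length-filter (_⊆? s) ys ⟩
      length ys               ≡⟨ ys-length ⟩
      2 ^ (a * L)             ≤⟨ ^-monoʳ-≤ 2 (*-monoʳ-≤ a (≮⇒≥ j≮L)) ⟩
      2 ^ (a * j)             ≤⟨ m≤n*m (2 ^ (a * j)) (D + 3) {{>-nonZero (≤-trans (s≤s z≤n) (m≤n+m 3 D))}} ⟩
      (D + 3) * 2 ^ (a * j)   ∎
    ... | yes j<L with ∃-smallSuperset (2 ^ (q * j)) s ∣s∣≤
    ...   | t , t∈ , s⊆t = begin
      spanned ys s            ≤⟨ count-mono (_⊆? s) (_⊆? t) (λ e⊆s → ⊆-trans e⊆s s⊆t) ys ⟩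
      spanned ys t            ≤⟨ solve-count (spanned ys t) j<L (exponents t j<L t∈) ⟩
      (D + 3) * 2 ^ (a * j)   ∎

-- From dyadic thinning to matching bounds.

⊑-unique : {xs ys : List X} → xs ⊑ ys → Unique ys → Unique xs
⊑-unique [] [] = []
⊑-unique (y ∷ʳ xs⊑ys) (_ ∷ ys!) = ⊑-unique xs⊑ys ys!
⊑-unique (refl ∷ xs⊑ys) (y∉ys ∷ ys!) = Sublist.All-resp-⊆ xs⊑ys y∉ys ∷ ⊑-unique xs⊑ys ys!

module Construction (k q a : ℕ) .{{_ : NonZero k}} .{{_ : NonZero q}} (q<a : q < a) (a≤kq : a ≤ k * q) where

  -- `D` is large enough for k * 2 ^ (q (L + 1)) ≤ 2 ^ (D L) when L ≥ 1. In `C`, the factor `D + 3`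
  -- comes from `solve-count`, and `2 ^ a` is the loss from rounding a size up to the next dyadic
  -- one.
  D C : ℕ
  D = k + 2 * q
  C = (D + 3) * 2 ^ a

  open Sparsity a q C

  2^qL<2^q[1+L] : ∀ L → 2 ^ (q * L) < 2 ^ (q * suc L)
  2^qL<2^q[1+L] L = ^-monoʳ-< 2 (s≤s (s≤s z≤n)) (*-monoʳ-< q (n<1+n L))

  -- Writing the number as `d + c` keeps it at least `c`, so that L = 0 starts the induction on `d`;
  -- each increment passes at most one threshold.
  logarithm : ∀ c .{{_ : NonZero c}} d → ∃[ L ] c * 2 ^ (q * L) ≤ d + c × d + c < c * 2 ^ (q * suc L)
  logarithm c zero = 0 ,
    ≤-reflexive c2^0≡c ,
    subst (_< c * 2 ^ (q * 1)) c2^0≡c (*-monoʳ-< c (2^qL<2^q[1+L] 0))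
    where
    c2^0≡c : c * 2 ^ (q * 0) ≡ c
    c2^0≡c = trans (cong (λ e → c * 2 ^ e) (*-zeroʳ q)) (*-identityʳ c)
  logarithm c (suc d) with logarithm c d
  ... | L , lower , upper with suc d + c <? c * 2 ^ (q * suc L)
  ...   | yes below = L , m≤n⇒m≤1+n lower , below
  ...   | no ¬below = suc L , ≮⇒≥ ¬below , ≤-<-trans upper (*-monoʳ-< c (2^qL<2^q[1+L] (suc L)))

  2^aj^q≡2^qj^a : ∀ j → (2 ^ (a * j)) ^ q ≡ (2 ^ (q * j)) ^ a
  2^aj^q≡2^qj^a j = trans (^-*-assoc 2 (a * j) q)
    (trans (cong (2 ^_) (rotate a j q)) (sym (^-*-assoc 2 (q * j) a)))
    where
    rotate : ∀ a j q → a * j * q ≡ q * j * a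
    rotate = solve-∀

  -- Take j with 2 ^ (q j) ≤ 1 + |s| < 2 ^ (q (j + 1)) and apply the dyadic bound at level j + 1, a
  -- factor 2 ^ a above level j. The 1 added to |s| provides such a j for empty `s` as well.
  dyadic⇒sparse : (ys : List (Subset n)) →
    (∀ j s → ∣ s ∣ ≤ 2 ^ (q * j) → spanned ys s ≤ (D + 3) * 2 ^ (a * j)) →
    ∀ s → spanned ys s ^ q ≤ C ^ q * suc ∣ s ∣ ^ a
  dyadic⇒sparse ys dyadic s with logarithm 1 ∣ s ∣
  ... | j , lower , upper = begin
    spanned ys s ^ q                          ≤⟨ ^-monoˡ-≤ q (dyadic (suc j) s small) ⟩
    ((D + 3) * 2 ^ (a * suc j)) ^ q           ≡⟨ cong (λ e → ((D + 3) * 2 ^ e) ^ q) (*-suc a j) ⟩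
    ((D + 3) * 2 ^ (a + a * j)) ^ q           ≡⟨ cong (λ u → ((D + 3) * u) ^ q) (^-distribˡ-+-* 2 a (a * j)) ⟩
    ((D + 3) * (2 ^ a * 2 ^ (a * j))) ^ q     ≡⟨ cong (_^ q) (*-assoc (D + 3) (2 ^ a) _) ⟨
    (C * 2 ^ (a * j)) ^ q                     ≡⟨ ^-distribʳ-* C (2 ^ (a * j)) q ⟩
    C ^ q * (2 ^ (a * j)) ^ q                 ≡⟨ cong (C ^ q *_) (2^aj^q≡2^qj^a j) ⟩
    C ^ q * (2 ^ (q * j)) ^ a                 ≤⟨ *-monoʳ-≤ (C ^ q) (^-monoˡ-≤ a (≤-trans (≤-reflexive (sym (*-identityˡ _))) lower)) ⟩
    C ^ q * (∣ s ∣ + 1) ^ a                   ≡⟨ cong (λ u → C ^ q * u ^ a) (+-comm ∣ s ∣ 1) ⟩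
    C ^ q * suc ∣ s ∣ ^ a                     ∎
    where
    open ≤-Reasoning
    small : ∣ s ∣ ≤ 2 ^ (q * suc j)
    small = ≤-trans (m≤m+n ∣ s ∣ 1) (<⇒≤ (subst (∣ s ∣ + 1 <_) (*-identityˡ _) upper))

  module _ (L d : ℕ) where
    open Partite (2 ^ (q * L)) d

    transversals-length : ∀ r → r + a ≡ k * q → length (transversals k) ≡ 2 ^ (a * L) * 2 ^ (r * L)
    transversals-length r r+a≡kq = begin
      length (transversals k)     ≡⟨ length-transversals k ⟩
      (2 ^ (q * L)) ^ k           ≡⟨ ^-*-assoc 2 (q * L) k ⟩
      2 ^ (q * L * k)             ≡⟨ cong (2 ^_) (rotate q L k) ⟩
      2 ^ (k * q * L)             ≡⟨ cong (λ e → 2 ^ (e * L)) r+a≡kq ⟨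
      2 ^ ((r + a) * L)           ≡⟨ cong (2 ^_) (expand r a L) ⟩
      2 ^ (a * L + r * L)         ≡⟨ ^-distribˡ-+-* 2 (a * L) (r * L) ⟩
      2 ^ (a * L) * 2 ^ (r * L)   ∎
      where
      open ≡-Reasoning
      rotate : ∀ q L k → q * L * k ≡ k * q * L
      rotate = solve-∀
      expand : ∀ r a L → (r + a) * L ≡ a * L + r * L
      expand = solve-∀

    -- For r = 0 the blocks have length 1 and nothing is left to choose: the complete partite
    -- hypergraph itself meets the bound, as m ^ k = m ^ (a/q).
    thinned : ∀ r → r + a ≡ k * q → .{{NonZero (order k)}} → (0 < L → order k ≤ 2 ^ (D * L)) →
      Σ[ ys ∈ List (Subset (order k)) ] ys ⊑ transversals k × length ys ≡ 2 ^ (a * L) ×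
        (∀ j s → ∣ s ∣ ≤ 2 ^ (q * j) → spanned ys s ≤ (D + 3) * 2 ^ (a * j))
    thinned zero a≡kq _ = transversals k , ⊑-refl ,
      trans (transversals-length 0 a≡kq) (*-identityʳ _) , λ j s ∣s∣≤ → begin
        spanned (transversals k) s    ≤⟨ spanned-transversals k s ⟩
        ∣ s ∣ ^ k                     ≤⟨ ^-monoˡ-≤ k ∣s∣≤ ⟩
        (2 ^ (q * j)) ^ k             ≡⟨ ^-*-assoc 2 (q * j) k ⟩
        2 ^ (q * j * k)               ≡⟨ cong (2 ^_) (rotate q j k) ⟩
        2 ^ (k * q * j)               ≡⟨ cong (λ e → 2 ^ (e * j)) a≡kq ⟨
        2 ^ (a * j)                   ≤⟨ m≤n*m (2 ^ (a * j)) (D + 3) {{>-nonZero (≤-trans (s≤s z≤n) (m≤n+m 3 D))}} ⟩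
        (D + 3) * 2 ^ (a * j)         ∎
      where
      open ≤-Reasoning
      rotate : ∀ q j k → q * j * k ≡ k * q * j
      rotate = solve-∀
    thinned r@(suc _) r+a≡kq n≤ = Thinning.thin {k = k} {D = D} {L = L} (transversals k) r+a≡kq q<a n≤
      (transversals-length r r+a≡kq) (spanned-transversals k)

    sparseHypergraph : .{{NonZero (order k)}} → (0 < L → order k ≤ 2 ^ (D * L)) →
      Σ[ G ∈ Hypergraph k (order k) ] Sparse G × ∣E G ∣ ≡ 2 ^ (a * L)
    sparseHypergraph n≤ with thinned (k * q ∸ a) (m∸n+n≡m a≤kq) n≤
    ... | ys , ys⊑ , len , dyadic = record
      { edges = ys
      ; unique = ⊑-unique ys⊑ (transversals-unique k)
      ; uniform = Sublist.All-resp-⊆ ys⊑ (transversals-uniform k)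
      } , dyadic⇒sparse ys dyadic , len

  k2^q[1+L]≤2^DL : ∀ L → 0 < L → k * 2 ^ (q * suc L) ≤ 2 ^ (D * L)
  k2^q[1+L]≤2^DL L@(suc l) _ = begin
    k * 2 ^ (q * suc L)         ≤⟨ *-monoˡ-≤ _ (<⇒≤ (n<2^n k)) ⟩
    2 ^ k * 2 ^ (q * suc L)     ≡⟨ ^-distribˡ-+-* 2 k _ ⟨
    2 ^ (k + q * suc L)
      ≤⟨ ^-monoʳ-≤ 2 (≤-trans (m≤m+n (k + q * suc (suc l)) (k * l + q * l)) (≤-reflexive (regroup k q l))) ⟩
    2 ^ (D * L)                 ∎
    where
    open ≤-Reasoning
    regroup : ∀ k q l → k + q * suc (suc l) + (k * l + q * l) ≡ (k + 2 * q) * suc l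
    regroup = solve-∀

  -- Takes the largest N = 2 ^ (q L) with k N ≤ n, so that n < 2 ^ q * k N, and pads with isolated
  -- vertices up to `n`.
  sparse-exists : ∀ n → k ≤ n → ∃[ L ] n < k * 2 ^ (q * suc L) ×
    (Σ[ G ∈ Hypergraph k n ] Sparse G × ∣E G ∣ ≡ 2 ^ (a * L))
  sparse-exists n k≤n with logarithm k (n ∸ k)
  ... | L , lower , upper = L , n< ,
    subst (λ n → Σ[ G ∈ Hypergraph k n ] Sparse G × ∣E G ∣ ≡ 2 ^ (a * L)) order≡n
      (sparseHypergraph L d {{subst NonZero (sym order≡n) (>-nonZero (<-≤-trans (>-nonZero⁻¹ k) k≤n))}}
        (λ 0<L → ≤-trans (≤-reflexive order≡n) (≤-trans (<⇒≤ n<) (k2^q[1+L]≤2^DL L 0<L))))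
    where
    n≡ : n ∸ k + k ≡ n
    n≡ = m∸n+n≡m k≤n
    n< : n < k * 2 ^ (q * suc L)
    n< = subst (_< _) n≡ upper
    d = n ∸ k * 2 ^ (q * L)
    order≡n : Partite.order (2 ^ (q * L)) d k ≡ n
    order≡n = trans (Partite.order≡ (2 ^ (q * L)) d k) (m+[n∸m]≡n (subst (k * 2 ^ (q * L) ≤_) n≡ lower))

  ex : ℕ → ℕ
  ex n = proj₁ (extremal k n)

  lower-bound : ∀ n → k ≤ n → n ^ a ≤ (k ^ a * 2 ^ a * ex n) ^ q
  lower-bound n k≤n with sparse-exists n k≤n
  ... | L , n< , G , sparse , ∣G∣≡ = begin
    n ^ a                                 ≤⟨ ^-monoˡ-≤ a (<⇒≤ n<) ⟩
    (k * 2 ^ (q * suc L)) ^ a             ≡⟨ ^-distribʳ-* k _ a ⟩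
    -- The natural constant would be k ^ (a/q), which may be irrational; the larger `k ^ a` replaces
    -- it.
    k ^ a * (2 ^ (q * suc L)) ^ a         ≤⟨ *-monoˡ-≤ _ (m≤m^q (k ^ a)) ⟩
    (k ^ a) ^ q * (2 ^ (q * suc L)) ^ a   ≡⟨ cong ((k ^ a) ^ q *_) (2^aj^q≡2^qj^a (suc L)) ⟨
    (k ^ a) ^ q * (2 ^ (a * suc L)) ^ q   ≡⟨ ^-distribʳ-* (k ^ a) _ q ⟨
    (k ^ a * 2 ^ (a * suc L)) ^ q
      ≡⟨ cong (λ u → (k ^ a * u) ^ q) (trans (cong (2 ^_) (*-suc a L)) (^-distribˡ-+-* 2 a (a * L))) ⟩
    (k ^ a * (2 ^ a * 2 ^ (a * L))) ^ q   ≡⟨ cong (_^ q) (*-assoc (k ^ a) (2 ^ a) _) ⟨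
    (k ^ a * 2 ^ a * 2 ^ (a * L)) ^ q     ≤⟨ ^-monoˡ-≤ q (*-monoʳ-≤ (k ^ a * 2 ^ a) 2^aL≤ex) ⟩
    (k ^ a * 2 ^ a * ex n) ^ q            ∎
    where
    open ≤-Reasoning
    2^aL≤ex : 2 ^ (a * L) ≤ ex n
    2^aL≤ex = ≤-trans (≤-reflexive (sym ∣G∣≡)) (IsEx.maximal (proj₂ (extremal k n)) G (Sparse⇒Free G sparse))

  -- Sparsity is applied to the whole vertex set; 1 + n ≤ 2 n for n ≥ 1 turns the shift in `Sparse`
  -- into a factor 2 ^ a.
  upper-bound : ∀ n → k ≤ n → ex n ^ q ≤ n ^ a * (C * 2 ^ a) ^ q
  upper-bound n k≤n with IsEx.attained (proj₂ (extremal k n))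
  ... | G , free , ∣G∣≡ = begin
    ex n ^ q                        ≡⟨ cong (_^ q) ∣G∣≡ ⟨
    ∣E G ∣ ^ q                      ≤⟨ ∣E∣-bound G (Free⇒Sparse G free) ⟩
    C ^ q * suc n ^ a               ≤⟨ *-monoʳ-≤ (C ^ q) (^-monoˡ-≤ a 1+n≤2n) ⟩
    C ^ q * (2 * n) ^ a             ≡⟨ cong (C ^ q *_) (^-distribʳ-* 2 n a) ⟩
    C ^ q * (2 ^ a * n ^ a)         ≤⟨ *-monoʳ-≤ (C ^ q) (*-monoˡ-≤ (n ^ a) (m≤m^q (2 ^ a))) ⟩
    C ^ q * ((2 ^ a) ^ q * n ^ a)   ≡⟨ regroup (C ^ q) _ (n ^ a) ⟩
    n ^ a * (C ^ q * (2 ^ a) ^ q)   ≡⟨ cong (n ^ a *_) (^-distribʳ-* C (2 ^ a) q) ⟨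
    n ^ a * (C * 2 ^ a) ^ q         ∎
    where
    open ≤-Reasoning
    1+n≤2n : suc n ≤ 2 * n
    1+n≤2n = ≤-trans (+-monoˡ-≤ n (<-≤-trans (>-nonZero⁻¹ k) k≤n)) (≤-reflexive (cong (n +_) (sym (+-identityʳ n))))
    regroup : ∀ x y z → x * (y * z) ≡ z * (x * y)
    regroup = solve-∀

-- Rational exponents.

-- Exposes numerator and denominator, so that a comparison with `fromℕ k` becomes an integer
-- inequality.
fromℕ≡ : ∀ k → fromℕ k ≡ mkℚ (ℤ.+ k) 0 (coprime-sym (1-coprimeTo k))
fromℕ≡ k = ℚ.normalize-coprime (coprime-sym (1-coprimeTo k))

-- Matching on `mkℚ` makes the numerator and denominator in `=Θ[n^_]` compute to `a` and `q`, so
-- both bounds apply verbatim. The inequalities 1 < α ≤ k become q < a ≤ k q.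
realise : ∀ k .{{_ : NonZero k}} α → 1ℚ ℚ.< α → α ℚ.≤ fromℕ k →
  Σ[ F ∈ Family k ] Σ[ ex ∈ (ℕ → ℕ) ] (∀ n → IsEx F n (ex n)) × ex =Θ[n^ α ]
realise k α@(mkℚ ℤ.-[1+ _ ] _ _) 1<α _ = contradiction (ℚ.drop-*<* 1<α) λ ()
realise k α@(mkℚ (ℤ.+ a) q-1 _) 1<α α≤k =
  Sparsity.Dense a q C , ex , (λ n → proj₂ (Sparsity.extremal a q C k n)) ,
  k ^ a * 2 ^ a , C * 2 ^ a , k , λ n k≤n → lower-bound n k≤n , upper-bound n k≤n
  where
  q = suc q-1
  q<a : q < a
  q<a = ℤ.drop‿+<+ (subst₂ ℤ._<_ (ℤ.*-identityˡ (ℤ.+ q)) (ℤ.*-identityʳ (ℤ.+ a)) (ℚ.drop-*<* 1<α))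
  a≤kq : a ≤ k * q
  a≤kq = ℤ.drop‿+≤+ (subst₂ ℤ._≤_ (ℤ.*-identityʳ (ℤ.+ a)) (sym (ℤ.pos-* k q))
    (ℚ.drop-*≤* (subst (α ℚ.≤_) (fromℕ≡ k) α≤k)))
  open Construction k q a q<a a≤kq

theorem2 : (k : ℕ) → 2 ≤ k → (r : ℚ) → 0ℚ ℚ.≤ r → r ℚ.< fromℕ k ℚ.- 1ℚ →
    Σ[ F ∈ Family k ] Σ[ ex ∈ (ℕ → ℕ) ]
    (∀ n → IsEx F n (ex n)) × ex =Θ[n^ fromℕ k ℚ.- r ]
theorem2 k 2≤k r 0≤r r<k-1 =
  realise k {{>-nonZero (<-≤-trans (s≤s z≤n) 2≤k)}} (fromℕ k ℚ.- r) 1<k-r k-r≤k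
  where
  K = fromℕ k
  k-r≤k : K ℚ.- r ℚ.≤ K
  k-r≤k = subst (K ℚ.- r ℚ.≤_) (ℚ.+-identityʳ K) (ℚ.+-monoʳ-≤ K (ℚ.neg-antimono-≤ 0≤r))
  1<k-r : 1ℚ ℚ.< K ℚ.- r
  -- Adds 1 - r to both sides of r < k - 1.
  1<k-r = subst₂ ℚ._<_ (cancel r) (swap K r) (ℚ.+-monoˡ-< (1ℚ ℚ.- r) r<k-1)
    where
    open ≡-Reasoning
    cancel : ∀ r → r ℚ.+ (1ℚ ℚ.- r) ≡ 1ℚ
    cancel r = begin
      r ℚ.+ (1ℚ ℚ.- r)         ≡⟨ cong (r ℚ.+_) (ℚ.+-comm 1ℚ (ℚ.- r)) ⟩
      r ℚ.+ (ℚ.- r ℚ.+ 1ℚ)     ≡⟨ ℚ.+-assoc r (ℚ.- r) 1ℚ ⟨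
      r ℚ.- r ℚ.+ 1ℚ           ≡⟨ cong (ℚ._+ 1ℚ) (ℚ.+-inverseʳ r) ⟩
      0ℚ ℚ.+ 1ℚ                ≡⟨ ℚ.+-identityˡ 1ℚ ⟩
      1ℚ                       ∎
    swap : ∀ K r → K ℚ.- 1ℚ ℚ.+ (1ℚ ℚ.- r) ≡ K ℚ.- r
    swap K r = begin
      K ℚ.- 1ℚ ℚ.+ (1ℚ ℚ.- r)          ≡⟨ ℚ.+-assoc K (ℚ.- 1ℚ) (1ℚ ℚ.- r) ⟩
      K ℚ.+ (ℚ.- 1ℚ ℚ.+ (1ℚ ℚ.- r))    ≡⟨ cong (K ℚ.+_) (ℚ.+-assoc (ℚ.- 1ℚ) 1ℚ (ℚ.- r)) ⟨
      K ℚ.+ (0ℚ ℚ.- r)                 ≡⟨ cong (K ℚ.+_) (ℚ.+-identityˡ (ℚ.- r)) ⟩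
      K ℚ.- r                          ∎
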